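{- Let $n\geq 4$ with $n\equiv 0$ or $1 \pmod 4$. Then the line graph $L(K_n)$ of the complete graph $K_n$ has the PMH--property, i.e. every perfect matching of $L(K_n)$ is contained in some hamiltonian cycle of $L(K_n)$.
   Context: The line graph $L(G)$ has vertex set $E(G)$, two vertices being adjacent when the corresponding edges of $G$ share an end-vertex. A graph has the PMH--property if each of its perfect matchings can be extended to a hamiltonian cycle. -}

module Defs where

open import Data.Nat as ℕ using (ℕ; _≤_)
open import Data.Fin using (Fin; zero; suc; inject₁; fromℕ; _<_)
open import Data.Product using (Σ; _×_; _,_; proj₁; proj₂; ∃)
open import Data.Sum using (_⊎_)
open import Relation.Binary.PropositionalEquality using (_≡_; _≢_)
open import Function.Definitions using (Bijective)

record Graph : Set₁ where
  field
    V   : Set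
    Adj : V → V → Set

module _ (G : Graph) where
  open Graph G

  record PerfectMatching : Set where
    field
      partner    : V → V
      isEdge     : ∀ v → Adj v (partner v)
      involutive : ∀ v → partner (partner v) ≡ v

  -- A hamiltonian cycle of length suc m (m ≥ 2, i.e. at least 3 vertices):
  -- a bijective cyclic enumeration c 0, c 1, …, c m of all vertices, with
  -- consecutive vertices adjacent and c m adjacent to c 0.
  record HamiltonianCycle : Set where
    field
      m         : ℕ
      length≥3  : 2 ≤ m
      walk      : Fin (ℕ.suc m) → V
      bijective : Bijective _≡_ _≡_ walk
      step      : ∀ (i : Fin m) → Adj (walk (inject₁ i)) (walk (suc i))
      close     : Adj (walk (fromℕ m)) (walk zero)

    CycleEdge : V → V → Set
    CycleEdge u w =
      (Σ (Fin m) λ i →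
         (walk (inject₁ i) ≡ u × walk (suc i) ≡ w)
         ⊎ (walk (inject₁ i) ≡ w × walk (suc i) ≡ u))
      ⊎ ((walk (fromℕ m) ≡ u × walk zero ≡ w)
         ⊎ (walk (fromℕ m) ≡ w × walk zero ≡ u))

  ExtendsTo : PerfectMatching → HamiltonianCycle → Set
  ExtendsTo M H = ∀ v → HamiltonianCycle.CycleEdge H v (PerfectMatching.partner M v)

  PMH : Set
  PMH = (M : PerfectMatching) → Σ HamiltonianCycle λ H → ExtendsTo M H

-- The complete graph K_n on vertex set Fin n.
-- Its edges: pairs (a , b) with a < b (each unordered pair once).
EdgeK : ℕ → Set
EdgeK n = Σ (Fin n × Fin n) λ p → proj₁ p < proj₂ p

ShareEnd : ∀ {n} → EdgeK n → EdgeK n → Set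
ShareEnd ((a , b) , _) ((c , d) , _) = a ≡ c ⊎ a ≡ d ⊎ b ≡ c ⊎ b ≡ d

LK : ℕ → Graph
LK n = record
  { V   = EdgeK n
  ; Adj = λ e f → e ≢ f × ShareEnd e f
  }

{-# OPTIONS --safe #-}
-- A perfect matching of L(K_n) splits E(K_n) into pairs of edges meeting at a
-- common vertex, the centre of the pair.  Directing every edge towards the centre
-- of its pair gives a tournament in which the edges of a directed path belong to
-- distinct pairs.  A hamiltonian cycle extending the matching amounts to a cyclic
-- order of the pairs in which each is traversed between two vertices, one of each
-- of its edges, or as a loop at its centre.  So it suffices to find a cycle through
-- all the centres whose edges lie in distinct pairs: every other pair becomes a
-- loop, inserted when the cycle visits its centre.
--
-- Take a hamiltonian directed path v b … y z (Rédei).  Closing it with the edge v z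
-- fails only if v → z and v z is paired with y z.  In that case either v precedes
-- every other vertex, hence is no centre and can be dropped, or v can be inserted
-- later in the path b … y z; the new path starts at b, and its last edge is y z or
-- v z, neither of which is in the pair of b z.
module Submission where

open import Defs
open import Data.Nat using (ℕ; _≤_; _%_; suc; z≤n; s≤s)
open import Data.Fin using (Fin; zero; suc; inject₁; fromℕ; _<_)
open import Data.Fin.Properties using (<-irrelevant; <-asym; <-cmp; _≟_; _<?_; suc-injective)
open import Data.Product using (Σ; ∃; _×_; _,_; proj₁; proj₂)
open import Data.Product.Properties using (≡-dec)
open import Data.Sum using (_⊎_; inj₁; inj₂)
open import Data.Empty using (⊥-elim)
open import Data.List using (List; []; _∷_; _++_; length; lookup; filter; deduplicate; allFin; concatMap)
open import Data.List.Membership.Propositional using (_∈_; _∉_; find)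
open import Data.List.Membership.Propositional.Properties
  using (∈-allFin; ∈-concatMap⁺; ∈-lookup)
open import Data.List.Relation.Unary.Any using (Any; here; there; index)
import Data.List.Relation.Unary.Any as Any
import Data.List.Relation.Unary.Any.Properties as Any
open import Data.List.Relation.Unary.All using (All; []; _∷_; all?)
import Data.List.Relation.Unary.All as All
import Data.List.Relation.Unary.All.Properties as All
open import Data.List.Relation.Unary.AllPairs using (AllPairs; []; _∷_)
import Data.List.Relation.Unary.AllPairs.Properties as AllPairs
open import Data.List.Relation.Unary.Unique.Propositional using (Unique)
open import Data.List.Relation.Unary.Unique.Propositional.Properties using (allFin⁺)
open import Data.List.Relation.Binary.Permutation.Propositional
  using (_↭_; ↭-refl; ↭-sym; ↭-trans; prep; swap; ↭⇒↭ₛ)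
open import Data.List.Relation.Binary.Permutation.Propositional.Properties
  using (∈-resp-↭; ↭-length; ++-comm)
import Data.List.Relation.Binary.Permutation.Setoid.Properties as PermutationSetoid
open import Function using (_∘_)
open import Relation.Binary using (tri<; tri≈; tri>)
open import Relation.Binary.PropositionalEquality
  using (_≡_; _≢_; refl; sym; trans; cong; subst; setoid; ≢-sym)
open import Relation.Nullary using (¬_; Dec; yes; no; _×-dec_; _⊎-dec_; ¬?)

-- Lists without repetitions.

module _ {A : Set} where

  Unique-resp-↭ : {xs ys : List A} → xs ↭ ys → Unique xs → Unique ys
  Unique-resp-↭ π = PermutationSetoid.Unique-resp-↭ (setoid A) (↭⇒↭ₛ π)

  All≢⇒∉ : {x : A} {xs : List A} → All (x ≢_) xs → x ∉ xs
  All≢⇒∉ = All.All¬⇒¬Any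

  lookup-injective : {xs : List A} → Unique xs → ∀ {i j} → lookup xs i ≡ lookup xs j → i ≡ j
  lookup-injective (_ ∷ _)  {zero}  {zero}  _  = refl
  lookup-injective (x≢ ∷ _) {zero}  {suc j} eq = ⊥-elim (All.lookup x≢ (∈-lookup j) eq)
  lookup-injective (x≢ ∷ _) {suc i} {zero}  eq = ⊥-elim (All.lookup x≢ (∈-lookup i) (sym eq))
  lookup-injective (_ ∷ u)  {suc i} {suc j} eq = cong suc (lookup-injective u eq)

-- Edges of the complete graph and their ends.

module _ {n : ℕ} where

  infix 4 _∈ᵉ_

  _∈ᵉ_ : Fin n → EdgeK n → Set
  p ∈ᵉ e = p ≡ proj₁ (proj₁ e) ⊎ p ≡ proj₂ (proj₁ e)

  _≟ᵉ_ : (e f : EdgeK n) → Dec (e ≡ f)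
  _≟ᵉ_ = ≡-dec (≡-dec _≟_ _≟_) (λ p q → yes (<-irrelevant p q))

  ∈ᵉ-pigeonhole : ∀ {a b c} {e : EdgeK n} → a ∈ᵉ e → b ∈ᵉ e → c ∈ᵉ e → a ≢ c → b ≢ c → a ≡ b
  ∈ᵉ-pigeonhole (inj₁ refl) (inj₁ refl) _ _ _ = refl
  ∈ᵉ-pigeonhole (inj₂ refl) (inj₂ refl) _ _ _ = refl
  ∈ᵉ-pigeonhole (inj₁ refl) (inj₂ refl) (inj₁ refl) a≢c _ = ⊥-elim (a≢c refl)
  ∈ᵉ-pigeonhole (inj₁ refl) (inj₂ refl) (inj₂ refl) _ b≢c = ⊥-elim (b≢c refl)
  ∈ᵉ-pigeonhole (inj₂ refl) (inj₁ refl) (inj₁ refl) _ b≢c = ⊥-elim (b≢c refl)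
  ∈ᵉ-pigeonhole (inj₂ refl) (inj₁ refl) (inj₂ refl) a≢c _ = ⊥-elim (a≢c refl)

  ∈ᵉ-ext : ∀ {a b} {e f : EdgeK n} → a ≢ b → a ∈ᵉ e → b ∈ᵉ e → a ∈ᵉ f → b ∈ᵉ f → e ≡ f
  ∈ᵉ-ext a≢b (inj₁ refl) (inj₁ refl) _ _ = ⊥-elim (a≢b refl)
  ∈ᵉ-ext a≢b (inj₂ refl) (inj₂ refl) _ _ = ⊥-elim (a≢b refl)
  ∈ᵉ-ext a≢b _ _ (inj₁ refl) (inj₁ refl) = ⊥-elim (a≢b refl)
  ∈ᵉ-ext a≢b _ _ (inj₂ refl) (inj₂ refl) = ⊥-elim (a≢b refl)
  ∈ᵉ-ext {e = _ , p} {_ , q} _ (inj₁ refl) (inj₂ refl) (inj₁ refl) (inj₂ refl) = cong (_ ,_) (<-irrelevant p q)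
  ∈ᵉ-ext {e = _ , p} {_ , q} _ (inj₂ refl) (inj₁ refl) (inj₂ refl) (inj₁ refl) = cong (_ ,_) (<-irrelevant p q)
  ∈ᵉ-ext {e = _ , p} {_ , q} _ (inj₁ refl) (inj₂ refl) (inj₂ refl) (inj₁ refl) = ⊥-elim (<-asym p q)
  ∈ᵉ-ext {e = _ , p} {_ , q} _ (inj₂ refl) (inj₁ refl) (inj₁ refl) (inj₂ refl) = ⊥-elim (<-asym p q)

  join : ∀ {a b} → a ≢ b → ∃ λ (e : EdgeK n) → a ∈ᵉ e × b ∈ᵉ e
  join {a} {b} a≢b with <-cmp a b
  ... | tri< a<b _ _ = ((a , b) , a<b) , inj₁ refl , inj₂ refl
  ... | tri≈ _ a≡b _ = ⊥-elim (a≢b a≡b)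
  ... | tri> _ _ b<a = ((b , a) , b<a) , inj₂ refl , inj₁ refl

  otherEnd : ∀ {p} {e : EdgeK n} → p ∈ᵉ e → ∃ λ q → q ∈ᵉ e × q ≢ p
  otherEnd {e = (a , b) , a<b} (inj₁ refl) = b , inj₂ refl , λ { refl → <-asym a<b a<b }
  otherEnd {e = (a , b) , a<b} (inj₂ refl) = a , inj₁ refl , λ { refl → <-asym a<b a<b }

  ∈ᵉ⇒ShareEnd : ∀ {p} {e f : EdgeK n} → p ∈ᵉ e → p ∈ᵉ f → ShareEnd e f
  ∈ᵉ⇒ShareEnd (inj₁ refl) (inj₁ q) = inj₁ q
  ∈ᵉ⇒ShareEnd (inj₁ refl) (inj₂ q) = inj₂ (inj₁ q)
  ∈ᵉ⇒ShareEnd (inj₂ refl) (inj₁ q) = inj₂ (inj₂ (inj₁ q))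
  ∈ᵉ⇒ShareEnd (inj₂ refl) (inj₂ q) = inj₂ (inj₂ (inj₂ q))

  ShareEnd⇒∈ᵉ : {e f : EdgeK n} → ShareEnd e f → ∃ λ p → p ∈ᵉ e × p ∈ᵉ f
  ShareEnd⇒∈ᵉ (inj₁ q)               = _ , inj₁ refl , inj₁ q
  ShareEnd⇒∈ᵉ (inj₂ (inj₁ q))        = _ , inj₁ refl , inj₂ q
  ShareEnd⇒∈ᵉ (inj₂ (inj₂ (inj₁ q))) = _ , inj₂ refl , inj₁ q
  ShareEnd⇒∈ᵉ (inj₂ (inj₂ (inj₂ q))) = _ , inj₂ refl , inj₂ q

  edgesFrom : Fin n → Fin n → List (EdgeK n)
  edgesFrom a b with a <? b
  ... | yes a<b = ((a , b) , a<b) ∷ []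
  ... | no _    = []

  allEdges : List (EdgeK n)
  allEdges = concatMap (λ a → concatMap (edgesFrom a) (allFin n)) (allFin n)

  ∈-edgesFrom : ∀ {a b} (a<b : a < b) → ((a , b) , a<b) ∈ edgesFrom a b
  ∈-edgesFrom {a} {b} a<b with a <? b
  ... | yes p = here (cong (_ ,_) (<-irrelevant a<b p))
  ... | no ¬p = ⊥-elim (¬p a<b)

  ∈-allEdges : ∀ e → e ∈ allEdges
  ∈-allEdges ((a , b) , a<b) =
    ∈-concatMap⁺ _ (Any.map (λ { refl →
      ∈-concatMap⁺ _ (Any.map (λ { refl → ∈-edgesFrom a<b }) (∈-allFin b)) }) (∈-allFin a))

-- The pairs of the matching and their centres.

module _ {n : ℕ} (M : PerfectMatching (LK n)) where
  open PerfectMatching M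

  private
    E = EdgeK n

  infix 4 _≈_ _≉_ _≈?_

  _≈_ _≉_ : E → E → Set
  e ≈ f = e ≡ f ⊎ partner e ≡ f
  e ≉ f = ¬ e ≈ f

  _≈?_ : ∀ e f → Dec (e ≈ f)
  e ≈? f = (e ≟ᵉ f) ⊎-dec (partner e ≟ᵉ f)

  ≈-sym : ∀ {e f} → e ≈ f → f ≈ e
  ≈-sym (inj₁ refl) = inj₁ refl
  ≈-sym (inj₂ refl) = inj₂ (involutive _)

  ≈-trans : ∀ {e f g} → e ≈ f → f ≈ g → e ≈ g
  ≈-trans (inj₁ refl) q           = q
  ≈-trans (inj₂ refl) (inj₁ refl) = inj₂ refl
  ≈-trans (inj₂ refl) (inj₂ refl) = inj₁ (sym (involutive _))

  centre : E → Fin n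
  centre e = proj₁ (ShareEnd⇒∈ᵉ {e = e} {partner e} (proj₂ (isEdge e)))

  centre-∈ : ∀ e → centre e ∈ᵉ e
  centre-∈ e = proj₁ (proj₂ (ShareEnd⇒∈ᵉ {e = e} {partner e} (proj₂ (isEdge e))))

  centre-∈-partner : ∀ e → centre e ∈ᵉ partner e
  centre-∈-partner e = proj₂ (proj₂ (ShareEnd⇒∈ᵉ {e = e} {partner e} (proj₂ (isEdge e))))

  -- Two different common ends would make `e` and `partner e` the same edge, which adjacency in the
  -- line graph excludes.
  centre-partner : ∀ e → centre (partner e) ≡ centre e
  centre-partner e with centre (partner e) ≟ centre e
  ... | yes eq = eq
  ... | no neq = ⊥-elim (proj₁ (isEdge e) (∈ᵉ-ext neq
          (subst (centre (partner e) ∈ᵉ_) (involutive e) (centre-∈-partner (partner e))) (centre-∈ e)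
          (centre-∈ (partner e)) (centre-∈-partner e)))

  centre-cong : ∀ {e f} → e ≈ f → centre e ≡ centre f
  centre-cong (inj₁ refl) = refl
  centre-cong (inj₂ refl) = sym (centre-partner _)

  -- The tournament of edges directed towards centres.

  infix 4 _⇒_

  record _⇒_ (a b : Fin n) : Set where
    constructor arc
    field
      edge   : E
      tail-∈ : a ∈ᵉ edge
      head   : centre edge ≡ b
      a≢b    : a ≢ b

    head-∈ : b ∈ᵉ edge
    head-∈ = subst (_∈ᵉ edge) head (centre-∈ edge)

  open _⇒_

  edge-unique : ∀ {a b} (s t : a ⇒ b) → edge s ≡ edge t
  edge-unique s t = ∈ᵉ-ext (a≢b s) (tail-∈ s) (head-∈ s) (tail-∈ t) (head-∈ t)

  -- An edge has only one end besides its head.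
  tail-unique : ∀ {a b z} (s : a ⇒ z) (t : b ⇒ z) → edge s ≡ edge t → a ≡ b
  tail-unique s t eq =
    ∈ᵉ-pigeonhole {e = edge s} (tail-∈ s) (subst (_∈ᵉ_ _) (sym eq) (tail-∈ t)) (head-∈ s) (a≢b s) (a≢b t)

  compare : ∀ {a b} → a ≢ b → a ⇒ b ⊎ b ⇒ a
  compare {a} {b} a≢b with join a≢b
  ... | e , a∈e , b∈e with centre e ≟ a
  ...   | yes c≡a = inj₂ (arc e b∈e c≡a (≢-sym a≢b))
  ...   | no  c≢a = inj₁ (arc e a∈e (∈ᵉ-pigeonhole {e = e} (centre-∈ e) b∈e a∈e c≢a (≢-sym a≢b)) a≢b)

  ⇒-asym : ∀ {a b} → a ⇒ b → ¬ b ⇒ a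
  ⇒-asym s t = a≢b s (trans (sym (head t))
    (trans (cong centre (∈ᵉ-ext (a≢b t) (tail-∈ t) (head-∈ t) (head-∈ s) (tail-∈ s))) (head s)))

  -- Three different tails give three different edges, too many for one pair.
  pair-has-two-tails : ∀ {a b c z} (s : a ⇒ z) (t : b ⇒ z) (u : c ⇒ z) →
                  a ≢ b → b ≢ c → c ≢ a → edge s ≈ edge t → edge s ≉ edge u
  pair-has-two-tails s t u a≢b b≢c c≢a p        (inj₁ q) = c≢a (sym (tail-unique s u q))
  pair-has-two-tails s t u a≢b b≢c c≢a (inj₁ p) (inj₂ q) = a≢b (tail-unique s t p)
  pair-has-two-tails s t u a≢b b≢c c≢a (inj₂ p) (inj₂ q) = b≢c (tail-unique t u (trans (sym p) q))

  -- Directed paths and their extension by a vertex.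

  -- Path a z ws is a directed path from a to z; ws lists its vertices backwards.
  infixl 5 _∷ʳ_

  data Path (a : Fin n) : Fin n → List (Fin n) → Set where
    []   : Path a a (a ∷ [])
    _∷ʳ_ : ∀ {y z ws} → Path a y ws → y ⇒ z → Path a z (z ∷ ws)

  start-∈ : ∀ {a z ws} → Path a z ws → a ∈ ws
  start-∈ []       = here refl
  start-∈ (P ∷ʳ _) = there (start-∈ P)

  end-∈ : ∀ {a z ws} → Path a z ws → z ∈ ws
  end-∈ []       = here refl
  end-∈ (_ ∷ʳ _) = here refl

  prepend : ∀ {a b z ws} → a ⇒ b → Path b z ws → Path a z (ws ++ a ∷ [])
  prepend s []       = [] ∷ʳ s
  prepend s (P ∷ʳ t) = prepend s P ∷ʳ t

  -- v goes right behind the last vertex of the path that precedes it.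
  insert : ∀ {v b z ws} → v ∉ ws → v ⇒ z → Path b z ws →
           (∃ λ ws′ → Path b z ws′ × ws′ ↭ v ∷ ws) ⊎ All (v ⇒_) ws
  insert v∉ t [] = inj₂ (t ∷ [])
  insert v∉ t (P ∷ʳ s) with compare {_} (λ { refl → v∉ (there (end-∈ P)) })
  ... | inj₂ r = inj₁ (_ , P ∷ʳ r ∷ʳ t , swap _ _ ↭-refl)
  ... | inj₁ r with insert (v∉ ∘ there) r P
  ...   | inj₁ (_ , P′ , π) = inj₁ (_ , P′ ∷ʳ s , ↭-trans (prep _ π) (swap _ _ ↭-refl))
  ...   | inj₂ v⇒           = inj₂ (t ∷ v⇒)

  -- The first arc is kept apart from `rest` because `extension` moves or drops the first vertex.
  record SpanningPath (xs : List (Fin n)) : Set where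
    constructor spanning
    field
      {v b z}  : Fin n
      {ws}     : List (Fin n)
      first    : v ⇒ b
      rest     : Path b z ws
      vertices : v ∷ ws ↭ xs

  extend : ∀ {u xs} → u ∉ xs → SpanningPath xs → SpanningPath (u ∷ xs)
  extend u∉ (spanning {v} {ws = ws} s Q π)
    with u∉′ ← u∉ ∘ ∈-resp-↭ π
    with compare (λ { refl → u∉′ (there (end-∈ Q)) })
  ... | inj₂ r = spanning s (Q ∷ʳ r) (↭-trans (swap _ _ ↭-refl) (prep _ π))
  ... | inj₁ r with insert (u∉′ ∘ there) r Q
  ...   | inj₁ (_ , Q′ , ρ) = spanning s Q′ (↭-trans (prep _ ρ) (↭-trans (swap _ _ ↭-refl) (prep _ π)))
  -- Now `u` precedes every vertex of `Q`, so it fits either in front of `v` or between `v` and the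
  -- start of `Q`.
  ...   | inj₂ u⇒ with compare (λ { refl → u∉′ (here refl) })
  ...     | inj₁ t = spanning t (prepend s Q) (prep _ (↭-trans (++-comm ws (v ∷ [])) π))
  ...     | inj₂ t = spanning t (prepend (All.lookup u⇒ (start-∈ Q)) Q)
              (↭-trans (prep _ (++-comm ws _)) (↭-trans (swap _ _ ↭-refl) (prep _ π)))

  rédei : ∀ {x y} xs → Unique (x ∷ y ∷ xs) → SpanningPath (x ∷ y ∷ xs)
  rédei [] ((x≢y ∷ _) ∷ _) with compare x≢y
  ... | inj₁ s = spanning s [] ↭-refl
  ... | inj₂ s = spanning s [] (swap _ _ ↭-refl)
  rédei (z ∷ xs) (x≢ ∷ u) = extend (All≢⇒∉ x≢) (rédei xs u)

  -- Walks through pairs and the resulting hamiltonian cycles.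

  -- Walk p es q: a walk from p to q traversing the pairs {e , partner e}, e ∈ es,
  -- each entered at an end of e and left at an end of partner e.
  data Walk (p : Fin n) : List E → Fin n → Set where
    []   : Walk p [] p
    step : ∀ {e q es r} → p ∈ᵉ e → q ∈ᵉ partner e → Walk q es r → Walk p (e ∷ es) r

  _++ʷ_ : ∀ {p q r es fs} → Walk p es q → Walk q fs r → Walk p (es ++ fs) r
  []         ++ʷ W′ = W′
  step i o W ++ʷ W′ = step i o (W ++ʷ W′)

  flat : List E → List E
  flat []       = []
  flat (e ∷ es) = e ∷ partner e ∷ flat es

  flat-∈ : ∀ {es e} → Any (e ≈_) es → e ∈ flat es
  flat-∈ (here (inj₁ refl)) = here refl
  flat-∈ (here (inj₂ refl)) = there (here (sym (involutive _)))
  flat-∈ (there i)          = there (there (flat-∈ i))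

  flat-≉ : ∀ {e es} → All (e ≉_) es → All (e ≢_) (flat es)
  flat-≉ []       = []
  flat-≉ (p ∷ ps) = (p ∘ inj₁) ∷ (λ { refl → p (inj₂ (involutive _)) }) ∷ flat-≉ ps

  flat-unique : ∀ {es} → AllPairs _≉_ es → Unique (flat es)
  flat-unique []       = []
  flat-unique (p ∷ ps) =
    (proj₁ (isEdge _) ∷ flat-≉ p) ∷
    flat-≉ (All.map (λ ≉ q → ≉ (≈-trans (inj₂ refl) q)) p) ∷ flat-unique ps

  -- The edge `x` by which the walk arrives at `p` makes the induction work: beyond the first pair,
  -- `partner e` takes its place.
  walk-step : ∀ {p q es x} → p ∈ᵉ x → Walk p es q → (i : Fin (length (flat es))) →
              ShareEnd (lookup (x ∷ flat es) (inject₁ i)) (lookup (flat es) i)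
  walk-step {x = x} x∋p (step {e = e} i o W) zero = ∈ᵉ⇒ShareEnd {e = x} {e} x∋p i
  walk-step x∋p (step {e = e} i o W) (suc zero) = proj₂ (isEdge e)
  walk-step x∋p (step {e = e} i o W) (suc (suc j)) = walk-step {x = partner e} o W j

  walk-end : ∀ {p q es x} → p ∈ᵉ x → Walk p es q →
             q ∈ᵉ lookup (x ∷ flat es) (fromℕ (length (flat es)))
  walk-end x∋p [] = x∋p
  walk-end x∋p (step {e = e} i o W) = walk-end {x = partner e} o W

  flat-consecutive : ∀ {es e} x → e ∈ es → Σ (Fin (length (flat es))) λ i →
                     lookup (x ∷ flat es) (inject₁ i) ≡ e × lookup (flat es) i ≡ partner e
  flat-consecutive x (here refl) = suc zero , refl , refl
  flat-consecutive x (there {x = e} e∈) with flat-consecutive (partner e) e∈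
  ... | i , p , q = suc (suc i) , p , q

  -- Successive edges meet at the centre inside a pair, and at the vertex where the walk passes from
  -- one pair to the next. Two pairs already give a cycle of length four.
  closedWalk⇒hamiltonian : ∀ {z g g′ es} → Walk z (g ∷ g′ ∷ es) z → AllPairs _≉_ (g ∷ g′ ∷ es) →
                           (∀ e → Any (e ≈_) (g ∷ g′ ∷ es)) →
                           Σ (HamiltonianCycle (LK n)) (ExtendsTo (LK n) M)
  closedWalk⇒hamiltonian {z} {g} {g′} {es} (step i o W) pairs cover = H , extends
    where
    xs ys : List E
    ys = flat (g′ ∷ es)
    xs = flat (g ∷ g′ ∷ es)

    inj : ∀ {i j} → lookup xs i ≡ lookup xs j → i ≡ j
    inj = lookup-injective (flat-unique pairs)

    share : ∀ i → ShareEnd (lookup xs (inject₁ i)) (lookup xs (suc i))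
    share zero    = proj₂ (isEdge g)
    share (suc i) = walk-step {x = partner g} o W i

    inject₁≢suc : ∀ {m} (i : Fin m) → inject₁ i ≢ suc i
    inject₁≢suc (suc i) eq = inject₁≢suc i (suc-injective eq)

    H : HamiltonianCycle (LK n)
    H = record
      { m         = suc (length ys)
      ; length≥3  = s≤s (s≤s z≤n)
      ; walk      = lookup xs
      ; bijective = inj , λ e → let e∈ = flat-∈ (cover e) in
                      index e∈ , λ { refl → sym (Any.lookup-index e∈) }
      ; step      = λ i → (λ eq → inject₁≢suc i (inj eq)) , share i
      ; close     = (λ eq → fromℕ≢0 (inj eq)) ,
                    ∈ᵉ⇒ShareEnd {e = lookup xs (fromℕ (suc (length ys)))} {g} (walk-end {x = partner g} o W) i
      }
      where
      fromℕ≢0 : ∀ {m} → fromℕ (suc m) ≢ zero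
      fromℕ≢0 ()

    consecutive : ∀ {e} → e ∈ g ∷ g′ ∷ es → Σ (Fin (suc (length ys))) λ i →
                  lookup xs (inject₁ i) ≡ e × lookup xs (suc i) ≡ partner e
    consecutive (here refl) = zero , refl , refl
    consecutive (there e∈) with flat-consecutive (partner g) e∈
    ... | i , p , q = suc i , p , q

    orient : ∀ {e f} → e ≈ f → f ∈ g ∷ g′ ∷ es → HamiltonianCycle.CycleEdge H e (partner e)
    orient (inj₁ refl) f∈ = let i , p , q = consecutive f∈ in inj₁ (i , inj₁ (p , q))
    -- The walk lists `partner e` instead of `e`, so the cycle edge is read backwards.
    orient (inj₂ refl) f∈ = let i , p , q = consecutive f∈ in
      inj₁ (i , inj₂ (p , trans q (involutive _)))

    extends : ExtendsTo (LK n) M H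
    extends e = let f , f∈ , e≈f = find (cover e) in orient e≈f f∈

  -- Pairs traversed as loops.

  representatives : List E
  representatives = deduplicate _≈?_ allEdges

  representatives-unique : AllPairs _≉_ representatives
  representatives-unique = go allEdges
    where
    go : ∀ es → AllPairs _≉_ (deduplicate _≈?_ es)
    go []       = []
    go (e ∷ es) = All.all-filter (¬? ∘ (e ≈?_)) (deduplicate _≈?_ es) ∷ AllPairs.filter⁺ _ (go es)

  representatives-cover : ∀ e → Any (e ≈_) representatives
  representatives-cover e =
    Any.deduplicate⁺ _≈?_ (λ p q → ≈-trans q (≈-sym p)) (Any.map inj₁ (∈-allEdges e))

  -- The pairs of the edges in `es` are reserved for edges of the cycle and must not recur as loops.
  Loop : Fin n → List E → E → Set
  Loop p es e = centre e ≡ p × All (_≉ e) es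

  loop? : ∀ p es e → Dec (Loop p es e)
  loop? p es e = (centre e ≟ p) ×-dec all? (λ f → ¬? (f ≈? e)) es

  loops : Fin n → List E → List E
  loops p es = filter (loop? p es) representatives

  loops-Loop : ∀ p es → All (Loop p es) (loops p es)
  loops-Loop p es = All.all-filter (loop? p es) representatives

  loops-unique : ∀ p es → AllPairs _≉_ (loops p es)
  loops-unique p es = AllPairs.filter⁺ (loop? p es) representatives-unique

  loops-walk : ∀ {p fs} → All (λ e → centre e ≡ p) fs → Walk p fs p
  loops-walk []          = []
  loops-walk (refl ∷ ps) = step (centre-∈ _) (centre-∈-partner _) (loops-walk ps)

  loops-cover : ∀ {p es e} → centre e ≡ p → All (_≉ e) es → Any (e ≈_) (loops p es)
  loops-cover {p} {es} {e} c≡p ≉e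
    with Any.filter⁺ (loop? p es) (representatives-cover e)
  ... | inj₁ found = found
  ... | inj₂ ¬loop = ⊥-elim (¬loop
          (trans (sym (centre-cong e≈r)) c≡p , All.map (λ ≉ q → ≉ (≈-trans q (≈-sym e≈r))) ≉e))
    where e≈r = Any.lookup-result (representatives-cover e)

  -- The tour of the pairs along a path.

  module _ (g : E) where

    -- The pair of `g` is kept for closing the path. Besides it, the loops at a vertex need only
    -- avoid the arriving arc, since all other arcs have their centres elsewhere.
    tour : ∀ {a z ws} → Path a z ws → List E
    tour {a} []           = loops a (g ∷ [])
    tour {z = z} (P ∷ʳ s) = tour P ++ edge s ∷ loops z (g ∷ edge s ∷ [])

    tour-walk : ∀ {a z ws} (P : Path a z ws) → Walk a (tour P) z
    tour-walk []       = loops-walk (All.map proj₁ (loops-Loop _ _))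
    tour-walk (P ∷ʳ s) = tour-walk P ++ʷ
      step (tail-∈ s) (subst (_∈ᵉ partner (edge s)) (head s) (centre-∈-partner (edge s)))
        (loops-walk (All.map proj₁ (loops-Loop _ _)))

    tour-centres : ∀ {a z ws} (P : Path a z ws) → All (λ e → centre e ∈ ws) (tour P)
    tour-centres []       = All.map (here ∘ proj₁) (loops-Loop _ _)
    tour-centres (P ∷ʳ s) = All.++⁺ (All.map there (tour-centres P))
      (here (head s) ∷ All.map (here ∘ proj₁) (loops-Loop _ _))

    -- Pairs met at different vertices of the path have different centres; those met at one vertex
    -- differ by the choice of the loops there.
    tour-unique : ∀ {a z ws} (P : Path a z ws) → Unique ws → AllPairs _≉_ (tour P)
    tour-unique [] _ = loops-unique _ _
    tour-unique {z = z} (P ∷ʳ s) (z≢ ∷ u) = AllPairs.++⁺ (tour-unique P u)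
      (All.map (λ { (_ , _ ∷ s≉e ∷ []) → s≉e }) (loops-Loop z _) ∷ loops-unique z _)
      (All.map (λ c∈ → differ c∈ (head s) ∷ All.map (differ c∈ ∘ proj₁) (loops-Loop z _))
        (tour-centres P))
      where
      differ : ∀ {e f} → centre e ∈ _ → centre f ≡ z → e ≉ f
      differ c∈ c≡z e≈f = All≢⇒∉ z≢ (subst (_∈ _) (trans (centre-cong e≈f) c≡z) c∈)

    arcs : ∀ {a z ws} → Path a z ws → List E
    arcs []       = []
    arcs (P ∷ʳ s) = edge s ∷ arcs P

    tour-avoids : ∀ {a z ws} (P : Path a z ws) → All (g ≉_) (arcs P) → All (g ≉_) (tour P)
    tour-avoids []       _        = All.map (λ { (_ , g≉ ∷ _) → g≉ }) (loops-Loop _ _)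
    tour-avoids (P ∷ʳ s) (p ∷ ps) = All.++⁺ (tour-avoids P ps)
      (p ∷ All.map (λ { (_ , g≉ ∷ _) → g≉ }) (loops-Loop _ _))

    -- A pair other than that of `g` is met at its centre, as the arriving arc or else as a loop.
    tour-cover : ∀ {a z ws} (P : Path a z ws) → ∀ {e} → g ≉ e → centre e ∈ ws → Any (e ≈_) (tour P)
    tour-cover []       g≉e (here c≡a) = loops-cover c≡a (g≉e ∷ [])
    tour-cover (P ∷ʳ s) g≉e (there c∈) = Any.++⁺ˡ (tour-cover P g≉e c∈)
    tour-cover (P ∷ʳ s) {e} g≉e (here c≡z) with edge s ≈? e
    ... | yes p = Any.++⁺ʳ (tour P) (here (≈-sym p))
    ... | no ¬p = Any.++⁺ʳ (tour P) (there (loops-cover c≡z (g≉e ∷ ¬p ∷ [])))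

    arcs-centres : ∀ {a z ws} (P : Path a z ws) → All (λ e → centre e ∈ ws) (arcs P)
    arcs-centres []       = []
    arcs-centres (P ∷ʳ s) = here (head s) ∷ All.map there (arcs-centres P)

    arcs-centres≢start : ∀ {a z ws} (P : Path a z ws) → Unique ws → All (λ e → centre e ≢ a) (arcs P)
    arcs-centres≢start []       _        = []
    arcs-centres≢start (P ∷ʳ s) (z≢ ∷ u) =
      (λ c≡a → All≢⇒∉ z≢ (subst (_∈ _) (trans (sym c≡a) (head s)) (start-∈ P)))
      ∷ arcs-centres≢start P u

  -- Closing a path to a cycle.

  Extension : Set
  Extension = Σ (HamiltonianCycle (LK n)) (ExtendsTo (LK n) M)

  -- The closed walk starts at `z`, crosses the pair of `g` to `a`, and returns by the tour along
  -- the path.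
  closeWith : ∀ g {a y z ws} (P : Path a y ws) (s : y ⇒ z) → Unique (z ∷ ws) → (∀ e → centre e ∈ z ∷ ws) →
              z ∈ᵉ g → a ∈ᵉ partner g → All (g ≉_) (arcs g (P ∷ʳ s)) → Extension
  closeWith g P s u cover z∈ a∈ avoid with tour g (P ∷ʳ s) | tour-walk g (P ∷ʳ s)
    | tour-unique g (P ∷ʳ s) u | tour-avoids g (P ∷ʳ s) avoid | tour-cover g (P ∷ʳ s) | avoid
  -- The tour is not empty, since it must meet the pair of `s`; this supplies the second pair of the
  -- closed walk.
  ... | [] | _ | _ | _ | covers | g≉s ∷ _ with () ← covers g≉s (cover (edge s))
  ... | _ ∷ _ | W | uniq | avoids | covers | _ =
    closedWalk⇒hamiltonian (step z∈ a∈ W) (avoids ∷ uniq) covered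
    where
    covered : ∀ e → Any (e ≈_) _
    covered e with g ≈? e
    ... | yes p = here (≈-sym p)
    ... | no ¬p = there (covers ¬p (cover e))

  -- The pair of the closing edge must not occur among the arcs. If `z ⇒ a`, its centre is `a`,
  -- which no arc enters. If `a ⇒ z`, it could only be the pair of `s`, the one arc into `z`, and
  -- `ok` rules this out.
  close : ∀ {a y z ws} (P : Path a y ws) (s : y ⇒ z) → Unique (z ∷ ws) → (∀ e → centre e ∈ z ∷ ws) →
          (∀ (t : a ⇒ z) → edge t ≉ edge s) → Extension
  close {a} {y} {z} P s u@(z≢ ∷ _) cover ok with compare (≢-sym (All.lookup z≢ (start-∈ P)))
  ... | inj₂ t = closeWith (edge t) P s u cover (tail-∈ t)
          (subst (_∈ᵉ partner (edge t)) (head t) (centre-∈-partner (edge t)))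
          (All.map (λ c≢a p → c≢a (trans (sym (centre-cong p)) (head t)))
            (arcs-centres≢start (edge t) (P ∷ʳ s) u))
  -- The partner comes first, because the pair has to be left at the tail `a` of `t`.
  ... | inj₁ t = closeWith (partner (edge t)) P s u cover
          (subst (_∈ᵉ partner (edge t)) (head t) (centre-∈-partner (edge t)))
          (subst (a ∈ᵉ_) (sym (involutive _)) (tail-∈ t))
          ((λ p → ok t (≈-trans (inj₂ refl) p)) ∷ All.map avoid (arcs-centres (partner (edge t)) P))
    where
    avoid : ∀ {e} → centre e ∈ _ → partner (edge t) ≉ e
    avoid c∈ p = All≢⇒∉ z≢
      (subst (_∈ _) (trans (sym (centre-cong (≈-trans (inj₂ refl) p))) (head t)) c∈)

  -- An edge with centre `v` would be an arc into `v` from its other end, which `v` precedes.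
  source-not-centre : ∀ {v ws} → All (v ⇒_) ws → (∀ u → u ∈ v ∷ ws) → ∀ e → centre e ∈ ws
  source-not-centre {v} v⇒ all e with all (centre e)
  ... | there c∈ = c∈
  ... | here c≡v with otherEnd {e = e} (centre-∈ e)
  ...   | u , u∈ , u≢c with all u
  ...     | here u≡v = ⊥-elim (u≢c (trans u≡v (sym c≡v)))
  ...     | there u∈ws = ⊥-elim (⇒-asym (All.lookup v⇒ u∈ws)
              (arc e u∈ c≡v (λ u≡v → u≢c (trans u≡v (sym c≡v)))))

  extension : ∀ {v b y z ws} → v ⇒ b → (Q : Path b y ws) (s : y ⇒ z) → b ≢ y →
              Unique (v ∷ z ∷ ws) → (∀ u → u ∈ v ∷ z ∷ ws) → Extension
  extension {v} {b} {y} {z} {ws} s₀ Q s b≢y unique@((v≢z ∷ v≢ws) ∷ unique′) all =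
    byClosingArc (compare v≢z)
    where
    closeAll : (∀ (t : v ⇒ z) → edge t ≉ edge s) → Extension
    closeAll = close (prepend s₀ Q) s (Unique-resp-↭ π unique) (λ e → ∈-resp-↭ π (all _))
      where
      π : v ∷ z ∷ ws ↭ z ∷ ws ++ v ∷ []
      π = ++-comm (v ∷ []) (z ∷ ws)

    byClosingArc : v ⇒ z ⊎ z ⇒ v → Extension
    byClosingArc (inj₂ r) = closeAll (λ t → ⊥-elim (⇒-asym r t))
    byClosingArc (inj₁ t) with edge t ≈? edge s
    ... | no ¬p = closeAll (λ t′ p → ¬p (≈-trans (inj₁ (edge-unique t t′)) p))
    ... | yes t≈s = reroute (compare v≢y)
      where
      v≢y : v ≢ y
      v≢y = All.lookup v≢ws (end-∈ Q)

      t≉ : (u : b ⇒ z) → edge t ≉ edge u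
      t≉ u = pair-has-two-tails t s u v≢y (≢-sym b≢y) (≢-sym (All.lookup v≢ws (start-∈ Q))) t≈s

      u≉s : (u : b ⇒ z) → edge u ≉ edge s
      u≉s u p = t≉ u (≈-trans t≈s (≈-sym p))

      reroute : v ⇒ y ⊎ y ⇒ v → Extension
      -- The new path is `b … y v z`, with last arc `t`.
      reroute (inj₂ r) = close (Q ∷ʳ r) t (Unique-resp-↭ (swap _ _ ↭-refl) unique)
        (λ e → ∈-resp-↭ (swap _ _ ↭-refl) (all _)) (λ u p → t≉ u (≈-sym p))
      reroute (inj₁ r) with insert (All≢⇒∉ v≢ws) r Q
      ... | inj₁ (_ , Q′ , ρ) = close Q′ s (Unique-resp-↭ π unique) (λ e → ∈-resp-↭ π (all _)) u≉s
        where
        π : v ∷ z ∷ ws ↭ z ∷ _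
        π = ↭-trans (swap _ _ ↭-refl) (prep _ (↭-sym ρ))
      -- Here `v` precedes every other vertex, so the path without it still contains all centres.
      ... | inj₂ v⇒ = close Q s unique′ (source-not-centre (t ∷ v⇒) all) u≉s

theorem3 : (n : ℕ) → 4 ≤ n → (n % 4 ≡ 0 ⊎ n % 4 ≡ 1) → PMH (LK n)
theorem3 n@(suc (suc (suc (suc _)))) (s≤s (s≤s (s≤s (s≤s _)))) _ M
  with rédei M _ (allFin⁺ n)
-- Four vertices force at least two arcs after the first one; hence `b` differs from the last vertex
-- but one.
... | spanning s₀ [] π with () ← ↭-length π
... | spanning s₀ ([] ∷ʳ _) π with () ← ↭-length π
... | spanning s₀ (Q ∷ʳ s′ ∷ʳ s) π =
  extension M s₀ (Q ∷ʳ s′) s b≢y unique (λ u → ∈-resp-↭ (↭-sym π) (∈-allFin u))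
  where
  unique = Unique-resp-↭ (↭-sym π) (allFin⁺ n)
  b≢y : _ ≢ _
  b≢y with _ ∷ (_ ∷ y≢ ∷ _) ← unique = ≢-sym (All.lookup y≢ (start-∈ M Q))
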